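{- Let $G$ be a finite, simple, connected graph with $\dim_{wt}(G)=2$ and let $\{u,v\}$ be a weak total metric basis of $G$. Then: (1) there is a unique geodesic (shortest path) $P$ between $u$ and $v$; (2) every neighbor of $u$ and every neighbor of $v$ has degree at most three; (3) every vertex of $P$ other than $u$, $v$ and their neighbors has degree at most five; (4) the maximum degree of $G$ is at most eight; (5) for each $w\in\{u,v\}$ and each $z\in N(w)$, every $r\in N(z)$ satisfies $r\not\sim w$.
   Context: $d(x,y)$ is the shortest-path distance, $N(x)$ the set of neighbors of $x$, and $x\sim y$ denotes adjacency. A set $W\subseteq V(G)$ is a resolving set if for every two distinct vertices $y,z$ there is $x\in W$ with $d(y,x)\ne d(z,x)$. A set $W$ is a weak total resolving set (WTR-set) if $W$ is resolving and, for every $w\in W$ and every $x\in V(G)\setminus W$, there is $w'\in W\setminus\{w\}$ with $d(x,w')\ne d(w,w')$. $\dim_{wt}(G)$ is the minimum cardinality of a WTR-set, and a weak total metric basis is a WTR-set of that cardinality. -}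

module Defs where

open import Data.Empty using (⊥-elim)
open import Data.Fin.Base using (Fin)
open import Data.Fin.Properties using (_≟_; any?; all?)
open import Data.Fin.Subset using (Subset; _∈_; _∉_; _-_; ∣_∣; ⊤)
open import Data.Fin.Subset.Properties using (_∈?_; anySubset?; ∈⊤)
open import Data.List.Base using (List; []; _∷_; length; head; last; map; allFin)
open import Data.List.Extrema.Nat using (max)
open import Data.List.Relation.Unary.All using ([])
open import Data.List.Relation.Unary.AllPairs using ([]; _∷_)
open import Data.List.Relation.Unary.Linked using (Linked; [-]; linked?)
open import Data.List.Relation.Unary.Unique.Propositional using (Unique)
open import Data.List.Relation.Unary.Unique.DecPropositional using (unique?)
open import Data.Maybe.Base using (just)
open import Data.Maybe.Properties using (≡-dec)
open import Data.Nat.Base using (ℕ; zero; suc; _≤_; z≤n; s≤s)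
import Data.Nat.Properties as ℕ
open import Data.Product.Base using (∃; ∃-syntax; _×_; _,_; proj₁; proj₂)
open import Data.Vec.Base using (tabulate)
open import Function.Base using (_∘_)
open import Level using (0ℓ)
open import Relation.Binary.Core using (Rel)
open import Relation.Binary.Definitions using (Decidable; Symmetric; Irreflexive)
open import Relation.Binary.PropositionalEquality using (_≡_; _≢_; refl; sym; trans)
open import Relation.Nullary.Decidable using (Dec; yes; no; does; map′; ¬?; _×-dec_; _→-dec_)
import Relation.Unary as U

IsMinimum : U.Pred ℕ 0ℓ → U.Pred ℕ 0ℓ
IsMinimum P k = P k × (∀ {l} → P l → k ≤ l)

minimum : {P : U.Pred ℕ 0ℓ} → U.Decidable P → ∀ k → P k → ∃ (IsMinimum P)
minimum P? zero p = 0 , p , λ _ → z≤n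
minimum {P} P? (suc k) p with P? 0
... | yes p₀ = 0 , p₀ , λ _ → z≤n
... | no ¬p₀ with minimum (P? ∘ suc) k p
...   | m , pₘ , least = suc m , pₘ , least′
  where
  least′ : ∀ {l} → P l → suc m ≤ l
  least′ {zero}  p₀ = ⊥-elim (¬p₀ p₀)
  least′ {suc l} pₗ = s≤s (least pₗ)

anyListOfLength? : ∀ {n} {P : U.Pred (List (Fin n)) 0ℓ} → U.Decidable P →
                   ∀ k → Dec (∃[ xs ] (P xs × length xs ≡ k))
anyListOfLength? P? zero =
  map′ (λ p → [] , p , refl) (λ { ([] , p , _) → p }) (P? [])
anyListOfLength? P? (suc k) =
  map′ (λ { (x , xs , p , refl) → x ∷ xs , p , refl })
       (λ { (x ∷ xs , p , refl) → x , xs , p , refl })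
       (any? λ x → anyListOfLength? (P? ∘ (x ∷_)) k)

record Graph (n : ℕ) : Set₁ where
  infix 4 _∼_ _∼?_
  field
    _∼_      : Rel (Fin n) 0ℓ
    _∼?_     : Decidable _∼_
    ∼-sym    : Symmetric _∼_
    ∼-irrefl : Irreflexive _≡_ _∼_

  N : Fin n → Subset n
  N x = tabulate λ y → does (x ∼? y)

  degree : Fin n → ℕ
  degree x = ∣ N x ∣

  maxDegree : ℕ
  maxDegree = max 0 (map degree (allFin n))

  -- A path is given by its list of vertices.
  IsPath : Fin n → Fin n → List (Fin n) → Set
  IsPath x y P =
    head P ≡ just x × last P ≡ just y × Linked _∼_ P × Unique P

  isPath? : ∀ x y → U.Decidable (IsPath x y)
  isPath? x y P =
    ≡-dec _≟_ (head P) (just x) ×-dec ≡-dec _≟_ (last P) (just y)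
      ×-dec linked? _∼?_ P ×-dec unique? _≟_ P

  -- Length counts edges, hence one less than the number of vertices.
  PathOfLength : Fin n → Fin n → ℕ → Set
  PathOfLength x y k = ∃[ P ] (IsPath x y P × length P ≡ suc k)

  pathOfLength? : ∀ x y → U.Decidable (PathOfLength x y)
  pathOfLength? x y k = anyListOfLength? (isPath? x y) (suc k)

  Connected : Set
  Connected = ∀ x y → ∃ (PathOfLength x y)

module Metric {n : ℕ} (G : Graph n) (connected : Graph.Connected G) where
  open Graph G

  minPath : ∀ x y → ∃ (IsMinimum (PathOfLength x y))
  minPath x y = minimum (pathOfLength? x y) (proj₁ (connected x y))
    (proj₂ (connected x y))

  d : Fin n → Fin n → ℕ
  d x y = proj₁ (minPath x y)

  d-isMinimum : ∀ x y → IsMinimum (PathOfLength x y) (d x y)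
  d-isMinimum x y = proj₂ (minPath x y)

  IsGeodesic : Fin n → Fin n → List (Fin n) → Set
  IsGeodesic x y P = IsPath x y P × length P ≡ suc (d x y)

  IsResolving : Subset n → Set
  IsResolving W = ∀ y z → y ≢ z → ∃[ x ] (x ∈ W × d y x ≢ d z x)

  IsWTR : Subset n → Set
  IsWTR W = IsResolving W ×
    (∀ w x → w ∈ W → x ∉ W → ∃[ w′ ] (w′ ∈ W - w × d x w′ ≢ d w w′))

  isWTR? : U.Decidable IsWTR
  isWTR? W =
    (all? λ y → all? λ z → ¬? (y ≟ z) →-dec
      any? λ x → (x ∈? W) ×-dec ¬? (d y x ℕ.≟ d z x))
    ×-dec
    (all? λ w → all? λ x → (w ∈? W) →-dec (¬? (x ∈? W) →-dec
      any? λ w′ → (w′ ∈? (W - w)) ×-dec ¬? (d x w′ ℕ.≟ d w w′)))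

  d-refl : ∀ x → d x x ≡ 0
  d-refl x = ℕ.n≤0⇒n≡0
    (proj₂ (d-isMinimum x x) (x ∷ [] , (refl , refl , [-] , [] ∷ []) , refl))

  d≡0⇒≡ : ∀ {x y} → d x y ≡ 0 → x ≡ y
  d≡0⇒≡ {x} {y} eq with d x y | proj₁ (d-isMinimum x y)
  d≡0⇒≡ refl | _ | _ ∷ [] , (refl , refl , _) , _ = refl

  ⊤-isWTR : IsWTR ⊤
  ⊤-isWTR =
      (λ y z y≢z → y , ∈⊤ , λ eq → y≢z (sym (d≡0⇒≡ (trans (sym eq) (d-refl y)))))
    , (λ w x _ x∉⊤ → ⊥-elim (x∉⊤ ∈⊤))

  WTROfSize : ℕ → Set
  WTROfSize k = ∃[ W ] (IsWTR W × ∣ W ∣ ≡ k)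

  minWTR : ∃ (IsMinimum WTROfSize)
  minWTR = minimum
    (λ k → anySubset? λ W → isWTR? W ×-dec (∣ W ∣ ℕ.≟ k))
    ∣ ⊤ {n} ∣ (⊤ , ⊤-isWTR , refl)

  dimwt : ℕ
  dimwt = proj₁ minWTR

  dimwt-isMinimum : IsMinimum WTROfSize dimwt
  dimwt-isMinimum = proj₂ minWTR

  IsWTMetricBasis : Subset n → Set
  IsWTMetricBasis W = IsWTR W × ∣ W ∣ ≡ dimwt

-- A vertex y is determined by its coordinates (d y u , d y v), which change by at
-- most one along an edge; so a vertex has at most eight neighbors, and at most
-- five when it lies on a geodesic, where d y u + d y v attains its minimum D = d u v.
-- The weak total condition says that no vertex but u has second coordinate D.
-- Hence the neighbors of u lie at (1 , D − 1) and (1 , D + 1), which are not adjacent,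
-- and a neighbor of u only sees u and two of the vertices with first coordinate 2.
module Submission where

open import Defs
open import Data.Fin.Base using (Fin)
open import Data.Fin.Subset using (_∈_; _∉_; ⁅_⁆; _∪_)
open import Data.List.Membership.Propositional using () renaming (_∈_ to _∈ₗ_)
open import Data.Nat.Base using (ℕ; _≤_)
open import Data.Product using (∃!; _×_)
open import Relation.Binary.PropositionalEquality using (_≡_; _≢_)
open import Relation.Nullary.Negation using (¬_)

open import Data.Fin.Base using (zero; suc)
open import Data.Fin.Properties using (_≟_; suc-injective)
open import Data.Fin.Subset using (Subset; inside; outside; ∣_∣; _-_)
open import Data.Fin.Subset.Properties
open import Data.List.Base using (List; []; _∷_; _++_; length; last; allFin)
open import Data.List.Extrema.Nat using (max≤v⁺)
open import Data.List.Membership.DecPropositional using () renaming (_∈?_ to ∈ₗ?)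
open import Data.List.Membership.Propositional.Properties using (∈-∃++; ∈-++⁻; ∈-++⁺ˡ; ∈-++⁺ʳ)
open import Data.List.Properties using (length-++-sucʳ)
open import Data.List.Relation.Unary.All using (tabulate)
open import Data.List.Relation.Unary.All.Properties using (¬Any⇒All¬; map⁺)
open import Data.List.Relation.Unary.AllPairs using ([]; _∷_)
open import Data.List.Relation.Unary.Any using (here; there)
open import Data.List.Relation.Unary.Linked using (Linked; [-]; _∷_)
open import Data.List.Relation.Unary.Unique.Propositional using (Unique)
open import Data.Maybe.Base using (just)
open import Data.Nat.Base using (zero; suc; pred; _+_; z≤n; s≤s)
open import Data.Nat.Properties hiding (_≟_; suc-injective)
open import Data.Product using (∃-syntax; _,_; proj₁; proj₂)
open import Data.Sum.Base using (_⊎_; inj₁; inj₂)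
open import Data.Vec.Base using ([]; _∷_; here; there)
open import Data.Vec.Properties using ([]=⇒lookup; lookup∘tabulate)
open import Function.Base using (_∘_; case_of_)
open import Relation.Binary.PropositionalEquality using (refl; sym; trans; cong; cong₂; subst)
open import Relation.Nullary.Decidable using (yes; no; does)
open import Relation.Nullary.Negation using (contradiction)

-- Counting subsets through injective codes

∣p∣≤length : ∀ {A : Set} {n} (p : Subset n) (c : Fin n → A) →
             (∀ {y z} → c y ≡ c z → y ≡ z) →
             ∀ xs → (∀ {y} → y ∈ p → c y ∈ₗ xs) → ∣ p ∣ ≤ length xs
∣p∣≤length []            c inj xs covered = z≤n
∣p∣≤length (outside ∷ p) c inj xs covered =
  ∣p∣≤length p (c ∘ suc) (suc-injective ∘ inj) xs (covered ∘ there)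
∣p∣≤length (inside ∷ p)  c inj xs covered with ∈-∃++ (covered here)
... | as , bs , refl = begin
  suc ∣ p ∣                       ≤⟨ s≤s (∣p∣≤length p (c ∘ suc) (suc-injective ∘ inj)
                                         (as ++ bs) (λ y∈p → drop (covered (there y∈p)))) ⟩
  suc (length (as ++ bs))         ≡⟨ length-++-sucʳ as (c zero) bs ⟨
  length (as ++ c zero ∷ bs)      ∎
  where
  open ≤-Reasoning
  drop : ∀ {y} → c (suc y) ∈ₗ as ++ c zero ∷ bs → c (suc y) ∈ₗ as ++ bs
  drop m with ∈-++⁻ as m
  ... | inj₁ m∈as          = ∈-++⁺ˡ m∈as
  ... | inj₂ (here eq)     = contradiction (inj eq) λ ()
  ... | inj₂ (there m∈bs)  = ∈-++⁺ʳ as m∈bs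

-- Removing `x` a second time changes nothing, whereas removing a member would lower the
-- cardinality.
x∉p-x : ∀ {n} (p : Subset n) (x : Fin n) → x ∉ p - x
x∉p-x p x x∈ = <-irrefl (cong ∣_∣ (p─q─q≡p─q p ⁅ x ⁆)) (x∈p⇒∣p-x∣<∣p∣ x∈)

∣⁅x⁆∪⁅y⁆∣≡2⇒x≢y : ∀ {n} {x y : Fin n} → ∣ ⁅ x ⁆ ∪ ⁅ y ⁆ ∣ ≡ 2 → x ≢ y
∣⁅x⁆∪⁅y⁆∣≡2⇒x≢y {x = x} eq refl =
  case trans (sym (∣⁅x⁆∣≡1 x)) (trans (cong ∣_∣ (sym (∪-idem ⁅ x ⁆))) eq) of λ ()

x∈⁅y⁆∪⁅z⁆⇒x≡y⊎x≡z : ∀ {n} {x y z : Fin n} → x ∈ ⁅ y ⁆ ∪ ⁅ z ⁆ → x ≡ y ⊎ x ≡ z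
x∈⁅y⁆∪⁅z⁆⇒x≡y⊎x≡z {y = y} {z} x∈ with x∈p∪q⁻ ⁅ y ⁆ ⁅ z ⁆ x∈
... | inj₁ x∈⁅y⁆ = inj₁ (x∈⁅y⁆⇒x≡y y x∈⁅y⁆)
... | inj₂ x∈⁅z⁆ = inj₂ (x∈⁅y⁆⇒x≡y z x∈⁅z⁆)

-- Naturals that differ by at most one

-- An inductive family rather than two inequalities, so that matching on several proofs leaves the
-- case analysis to unification.
data Near : ℕ → ℕ → Set where
  below : ∀ {a} → Near a (suc a)
  equal : ∀ {a} → Near a a
  above : ∀ {a} → Near (suc a) a

near : ∀ {a b} → a ≤ suc b → b ≤ suc a → Near a b
near {zero}  {zero}        p       q       = equal
near {zero}  {suc zero}    p       q       = below
near {zero}  {suc (suc b)} p       (s≤s ())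
near {suc zero}    {zero}  p       q       = above
near {suc (suc a)} {zero}  (s≤s ()) q
near {suc a} {suc b}       (s≤s p) (s≤s q) = near-suc (near p q)
  where
  near-suc : ∀ {a b} → Near a b → Near (suc a) (suc b)
  near-suc below = below
  near-suc equal = equal
  near-suc above = above

near-0 : ∀ {a} → Near a 0 → a ≢ 0 → a ≡ 1
near-0 equal a≢0 = contradiction refl a≢0
near-0 above _   = refl

near-1 : ∀ {a} → Near a 1 → a ≡ 0 ⊎ a ≡ 1 ⊎ a ≡ 2
near-1 below = inj₁ refl
near-1 equal = inj₂ (inj₁ refl)
near-1 above = inj₂ (inj₂ refl)

-- Both `a` and `b` are D - 1 or D + 1, and on opposite sides of `D` they would differ by two.
near-same-side : ∀ {a b D} → Near a D → a ≢ D → Near b D → b ≢ D → Near a b → a ≡ b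
near-same-side equal a≢D _     _   _ = contradiction refl a≢D
near-same-side _     _   equal b≢D _ = contradiction refl b≢D
near-same-side below _   below _   _ = refl
near-same-side below _   above _   ()
near-same-side above _   below _   ()
near-same-side above _   above _   _ = refl

-- Of the three values near `b`, the one towards `D` is `D` itself; `c` is the one on the far side.
near-away : ∀ {b D} → Near b D → b ≢ D →
            ∃[ c ] (∀ {b′} → Near b′ b → b′ ≢ D → b′ ≡ b ⊎ b′ ≡ c)
near-away {b} equal b≢D = contradiction refl b≢D
near-away {b} below _ = pred b , λ where
  below _    → inj₂ refl
  equal _    → inj₁ refl
  above b≢D  → contradiction refl b≢D
near-away {b} above _ = suc b , λ where
  below b≢D  → contradiction refl b≢D
  equal _    → inj₁ refl
  above _    → inj₂ refl

-- Neighboring positions in the coordinate grid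

-- The five of the eight surrounding positions whose coordinate sum does not drop. Truncation of
-- `pred` at 0 is harmless, as the list serves only as a cover.
upperRing : ℕ → ℕ → List (ℕ × ℕ)
upperRing a b = (pred a , suc b) ∷ (a , suc b) ∷ (suc a , pred b) ∷ (suc a , b) ∷ (suc a , suc b) ∷ []

ring : ℕ → ℕ → List (ℕ × ℕ)
ring a b = (pred a , pred b) ∷ (pred a , b) ∷ (a , pred b) ∷ upperRing a b

∈-upperRing : ∀ {a b a′ b′} → Near a′ a → Near b′ b → (a′ , b′) ≢ (a , b) →
              a + b ≤ a′ + b′ → (a′ , b′) ∈ₗ upperRing a b
∈-upperRing below below _  le = contradiction le (<⇒≱ (+-mono-<-≤ (n<1+n _) (n≤1+n _)))
∈-upperRing {b = b} below equal _ le = contradiction le (<⇒≱ (+-monoˡ-< b (n<1+n _)))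
∈-upperRing {a = a} equal below _ le = contradiction le (<⇒≱ (+-monoʳ-< a (n<1+n _)))
∈-upperRing equal equal ne _  = contradiction refl ne
∈-upperRing below above _  _  = here refl
∈-upperRing equal above _  _  = there (here refl)
∈-upperRing above below _  _  = there (there (here refl))
∈-upperRing above equal _  _  = there (there (there (here refl)))
∈-upperRing above above _  _  = there (there (there (there (here refl))))

∈-ring : ∀ {a b a′ b′} → Near a′ a → Near b′ b → (a′ , b′) ≢ (a , b) →
         (a′ , b′) ∈ₗ ring a b
∈-ring below below _  = here refl
∈-ring below equal _  = there (here refl)
∈-ring equal below _  = there (there (here refl))
∈-ring equal equal ne = contradiction refl ne
∈-ring below above _  = there (there (there (here refl)))
∈-ring equal above _  = there (there (there (there (here refl))))
∈-ring above below _  = there (there (there (there (there (here refl)))))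
∈-ring above equal _  = there (there (there (there (there (there (here refl))))))
∈-ring above above _  = there (there (there (there (there (there (there (here refl)))))))

-- Walks and their reduction to paths

module Walks {n : ℕ} (G : Graph n) where
  open Graph G

  infixr 5 _∷_
  data Walk : Fin n → Fin n → ℕ → Set where
    []  : ∀ {x} → Walk x x 0
    _∷_ : ∀ {x y z k} → x ∼ y → Walk y z k → Walk x z (suc k)

  -- The second walk is the accumulator: edges of the first are turned around and put in front of
  -- it.
  reverseAppend : ∀ {x y z i j} → Walk x y i → Walk x z j → Walk y z (i + j)
  reverseAppend []                    w = w
  reverseAppend {i = suc i} {j} (e ∷ p) w =
    subst (Walk _ _) (+-suc i j) (reverseAppend p (∼-sym e ∷ w))

  linked⇒walk : ∀ {x y} xs → last (x ∷ xs) ≡ just y → Linked _∼_ (x ∷ xs) →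
                Walk x y (length xs)
  linked⇒walk []       refl _       = []
  linked⇒walk (_ ∷ xs) l    (e ∷ r) = e ∷ linked⇒walk xs l r

  path⇒walk : ∀ {x y k} → PathOfLength x y k → Walk x y k
  path⇒walk (_ ∷ xs , (refl , l , r , _) , refl) = linked⇒walk xs l r

  suffixFrom : ∀ {x y} P → x ∈ₗ P → last P ≡ just y → Linked _∼_ P → Unique P →
               ∃[ Q ] (IsPath x y Q × length Q ≤ length P)
  suffixFrom P            (here refl) l r       u       = P , (refl , l , r , u) , ≤-refl
  suffixFrom (_ ∷ P@(_ ∷ _)) (there m) l (_ ∷ r) (_ ∷ u) with suffixFrom P m l r u
  ... | Q , isPath , le = Q , isPath , m≤n⇒m≤1+n le

  -- If the new first vertex already lies on the path, the loop is cut off by keeping the suffix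
  -- from that vertex. Thus `d`, a minimum over paths, bounds the length of every walk.
  walk⇒path : ∀ {x y k} → Walk x y k → ∃[ j ] (PathOfLength x y j × j ≤ k)
  walk⇒path {x} [] = 0 , (x ∷ [] , (refl , refl , [-] , tabulate (λ ()) ∷ []) , refl) , z≤n
  walk⇒path {x} (e ∷ w) with walk⇒path w
  ... | j , (P@(_ ∷ _) , (refl , l , r , u) , refl) , j≤k with ∈ₗ? _≟_ x P
  ...   | no x∉P = suc j , (x ∷ P , (refl , l , e ∷ r , ¬Any⇒All¬ P x∉P ∷ u) , refl) , s≤s j≤k
  ...   | yes x∈P with suffixFrom P x∈P l r u
  ...     | Q@(_ ∷ Q′) , isPath , s≤s le =
    length Q′ , (Q , isPath , refl) , m≤n⇒m≤1+n (≤-trans le j≤k)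

-- Metric properties of the distance

module Distance {n : ℕ} (G : Graph n) (connected : Graph.Connected G) where
  open Graph G
  open Metric G connected
  open Walks G

  shortest : ∀ x y → Walk x y (d x y)
  shortest x y = path⇒walk (proj₁ (d-isMinimum x y))

  d≤walk : ∀ {x y k} → Walk x y k → d x y ≤ k
  d≤walk {x} {y} w with walk⇒path w
  ... | j , p , j≤k = ≤-trans (proj₂ (d-isMinimum x y) p) j≤k

  -- The triangle inequality with both right-hand distances starting at `x`: in this form it
  -- precedes symmetry, which is its case `z = x`.
  d-fork : ∀ x y z → d y z ≤ d x y + d x z
  d-fork x y z = d≤walk (reverseAppend (shortest x y) (shortest x z))

  d-sym : ∀ x y → d x y ≡ d y x
  d-sym x y = ≤-antisym (le y x) (le x y)
    where
    le : ∀ x y → d y x ≤ d x y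
    le x y = ≤-trans (d-fork x y x)
      (≤-reflexive (trans (cong (d x y +_) (d-refl x)) (+-identityʳ _)))

  d-near : ∀ {x y} z → x ∼ y → Near (d x z) (d y z)
  d-near {x} {y} z x∼y = near (d≤walk (x∼y ∷ shortest y z)) (d≤walk (∼-sym x∼y ∷ shortest x z))

  d-adjacent : ∀ {x y} → x ∼ y → d x y ≡ 1
  d-adjacent {x} {y} x∼y =
    near-0 (subst (Near (d x y)) (d-refl y) (d-near y x∼y)) (λ eq → ∼-irrefl (d≡0⇒≡ eq) x∼y)

  ∈N⇒∼ : ∀ {x y} → y ∈ N x → x ∼ y
  ∈N⇒∼ {x} {y} y∈N with x ∼? y | trans (sym (lookup∘tabulate (λ z → does (x ∼? z)) y)) ([]=⇒lookup y∈N)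
  ... | yes x∼y | _ = x∼y

  -- Coordinates with respect to a resolving pair

  module Coordinates (u v : Fin n)
    (resolve : ∀ {y z} → d y u ≡ d z u → d y v ≡ d z v → y ≡ z) where

    D : ℕ
    D = d u v

    coords : Fin n → ℕ × ℕ
    coords y = d y u , d y v

    coords-injective : ∀ {y z} → coords y ≡ coords z → y ≡ z
    coords-injective eq = resolve (cong proj₁ eq) (cong proj₂ eq)

    degree≤ : ∀ x xs → (∀ {y} → x ∼ y → coords y ∈ₗ xs) → degree x ≤ length xs
    degree≤ x xs covered = ∣p∣≤length (N x) coords coords-injective xs (covered ∘ ∈N⇒∼)

    coords-distinct : ∀ {x y} → x ∼ y → coords y ≢ coords x
    coords-distinct x∼y eq = ∼-irrefl (sym (coords-injective eq)) x∼y

    degree≤8 : ∀ x → degree x ≤ 8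
    degree≤8 x = degree≤ x (ring (d x u) (d x v)) λ x∼y →
      ∈-ring (d-near u (∼-sym x∼y)) (d-near v (∼-sym x∼y)) (coords-distinct x∼y)

    between⇒degree≤5 : ∀ x → d x u + d x v ≡ D → degree x ≤ 5
    between⇒degree≤5 x eq = degree≤ x (upperRing (d x u) (d x v)) λ {y} x∼y →
      ∈-upperRing (d-near u (∼-sym x∼y)) (d-near v (∼-sym x∼y)) (coords-distinct x∼y)
        (≤-trans (≤-reflexive eq) (d-fork y u v))

    -- The two walks together have the least possible length `D`, so neither can be shortened.
    position : ∀ {x i j} → Walk x u i → Walk x v j → i + j ≡ D → d x u ≡ i × d x v ≡ j
    position {x} {i} {j} p q eq =
        ≤-antisym (d≤walk p) (+-cancelʳ-≤ j i (d x u) (≤-trans D≤ (+-monoʳ-≤ (d x u) (d≤walk q))))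
      , ≤-antisym (d≤walk q) (+-cancelˡ-≤ i j (d x v) (≤-trans D≤ (+-monoˡ-≤ (d x v) (d≤walk p))))
      where
      D≤ : i + j ≤ d x u + d x v
      D≤ = ≤-trans (≤-reflexive eq) (d-fork x u v)

    -- Moving along the path shifts one edge at a time from the remaining part to the walk back to
    -- `u`; the total stays `D`, so `position` applies at each vertex.
    on-geodesic⇒between : ∀ {x y i} xs → last (x ∷ xs) ≡ just v → Linked _∼_ (x ∷ xs) →
                          Walk x u i → i + length xs ≡ D →
                          y ∈ₗ x ∷ xs → d y u + d y v ≡ D
    on-geodesic⇒between xs l r w eq (here refl) =
      let (p , q) = position w (linked⇒walk xs l r) eq in trans (cong₂ _+_ p q) eq
    on-geodesic⇒between {i = i} (_ ∷ xs) l (e ∷ r) w eq (there m) =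
      on-geodesic⇒between xs l r (∼-sym e ∷ w) (trans (sym (+-suc i (length xs))) eq) m

    -- After `i` edges both geodesics are at coordinates (i, D - i), and `resolve` identifies the
    -- two vertices.
    geodesic-unique′ : ∀ {x x′ i} xs xs′ →
      last (x ∷ xs) ≡ just v → Linked _∼_ (x ∷ xs) → Walk x u i →
      last (x′ ∷ xs′) ≡ just v → Linked _∼_ (x′ ∷ xs′) → Walk x′ u i →
      length xs ≡ length xs′ → i + length xs ≡ D → x ∷ xs ≡ x′ ∷ xs′
    geodesic-unique′ {i = i} xs xs′ l r w l′ r′ w′ len eq =
      cong₂ _∷_ (resolve (trans p (sym p′)) (trans q (trans len (sym q′)))) (tails xs xs′ l r l′ r′ len eq)
      where
      pos  = position w (linked⇒walk xs l r) eq
      pos′ = position w′ (linked⇒walk xs′ l′ r′) (trans (cong (i +_) (sym len)) eq)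
      p = proj₁ pos
      q = proj₂ pos
      p′ = proj₁ pos′
      q′ = proj₂ pos′
      tails : ∀ xs xs′ → last (_ ∷ xs) ≡ just v → Linked _∼_ (_ ∷ xs) →
        last (_ ∷ xs′) ≡ just v → Linked _∼_ (_ ∷ xs′) →
        length xs ≡ length xs′ → i + length xs ≡ D → xs ≡ xs′
      tails []       []         _ _       _  _         _   _  = refl
      tails (_ ∷ xs) (_ ∷ xs′)  l (e ∷ r) l′ (e′ ∷ r′) len eq =
        geodesic-unique′ xs xs′ l r (∼-sym e ∷ w) l′ r′ (∼-sym e′ ∷ w′) (cong pred len)
          (trans (sym (+-suc i (length xs))) eq)

    geodesic-unique : ∀ {P Q} → IsGeodesic u v P → IsGeodesic u v Q → P ≡ Q
    geodesic-unique {_ ∷ xs} {_ ∷ xs′} ((refl , l , r , _) , len) ((refl , l′ , r′ , _) , len′) =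
      geodesic-unique′ xs xs′ l r [] l′ r′ [] (cong pred (trans len (sym len′))) (cong pred len)

    geodesic-∃! : ∃! _≡_ (IsGeodesic u v)
    geodesic-∃! =
      let (P , isPath , len) = proj₁ (d-isMinimum u v)
      in  P , (isPath , len) , geodesic-unique (isPath , len)

    geodesic-degree≤5 : ∀ {P x} → IsGeodesic u v P → x ∈ₗ P → degree x ≤ 5
    geodesic-degree≤5 {_ ∷ xs} ((refl , l , r , _) , len) m =
      between⇒degree≤5 _ (on-geodesic⇒between xs l r [] (cong pred len) m)

    -- Neighbors of a basis vertex

    module Isolated (isolated : ∀ {x} → d x v ≡ D → x ≡ u) where

      neighbor-near-D : ∀ {z} → z ∼ u → Near (d z v) D
      neighbor-near-D = d-near v

      neighbor≢D : ∀ {z} → z ∼ u → d z v ≢ D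
      neighbor≢D z∼u eq = ∼-irrefl (isolated eq) z∼u

      -- Adjacency would put the second coordinates of `z` and `r` on the same side of `D`, making
      -- them equal; the first coordinates are both 1, so `z` and `r` would coincide.
      triangle-free : ∀ {z r} → z ∼ u → r ∼ u → ¬ z ∼ r
      triangle-free {z} {r} z∼u r∼u z∼r = ∼-irrefl (resolve
        (trans (d-adjacent z∼u) (sym (d-adjacent r∼u)))
        (near-same-side (neighbor-near-D z∼u) (neighbor≢D z∼u)
          (neighbor-near-D r∼u) (neighbor≢D r∼u) (d-near v z∼r))) z∼r

      d≡1⇒∼ : ∀ {x} → d x u ≡ 1 → x ∼ u
      d≡1⇒∼ {x} eq = walk₁ (subst (Walk x u) eq (shortest x u))
        where
        walk₁ : ∀ {x y} → Walk x y 1 → x ∼ y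
        walk₁ (e ∷ []) = e

      neighbor-degree≤3 : ∀ {z} → z ∼ u → degree z ≤ 3
      neighbor-degree≤3 {z} z∼u =
        degree≤ z ((0 , D) ∷ (2 , d z v) ∷ (2 , c) ∷ []) covered
        where
        away = near-away (neighbor-near-D z∼u) (neighbor≢D z∼u)
        c = proj₁ away
        covered : ∀ {y} → z ∼ y → coords y ∈ₗ (0 , D) ∷ (2 , d z v) ∷ (2 , c) ∷ []
        covered {y} z∼y
          with near-1 (subst (Near (d y u)) (d-adjacent z∼u) (d-near u (∼-sym z∼y)))
        ... | inj₁ y₀ = here (cong₂ _,_ y₀ (cong (λ t → d t v) (d≡0⇒≡ y₀)))
        -- With first coordinate 1, `y` would close a triangle with `u` and `z`.
        ... | inj₂ (inj₁ y₁) = contradiction z∼y (triangle-free z∼u (d≡1⇒∼ y₁))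
        -- Second coordinate `D` would force `y` to be `u`, whose first coordinate is 0 and not 2.
        ... | inj₂ (inj₂ y₂) with proj₂ away (d-near v (∼-sym z∼y))
               (λ eq → case trans (sym y₂) (trans (cong (λ t → d t u) (isolated eq)) (d-refl u)) of λ ())
        ...   | inj₁ b = there (here (cong₂ _,_ y₂ b))
        ...   | inj₂ b = there (there (here (cong₂ _,_ y₂ b)))

  -- From the weak total condition to the coordinate hypotheses

  module Basis (u v : Fin n) (u≢v : u ≢ v) (wtr : IsWTR (⁅ u ⁆ ∪ ⁅ v ⁆)) where

    resolve : ∀ {y z} → d y u ≡ d z u → d y v ≡ d z v → y ≡ z
    resolve {y} {z} eq-u eq-v with y ≟ z
    ... | yes y≡z = y≡z
    ... | no y≢z with proj₁ wtr y z y≢z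
    ...   | x , x∈W , ne with x∈⁅y⁆∪⁅z⁆⇒x≡y⊎x≡z x∈W
    ...     | inj₁ refl = contradiction eq-u ne
    ...     | inj₂ refl = contradiction eq-v ne

    isolated : ∀ {x} → d x v ≡ d u v → x ≡ u
    isolated {x} eq with x ≟ u | x ≟ v
    ... | yes x≡u | _ = x≡u
    ... | no _    | yes refl = contradiction (d≡0⇒≡ (trans (sym eq) (d-refl v))) u≢v
    ... | no x≢u  | no x≢v
      -- Here `x` lies outside the basis, so the condition at `u` supplies a vertex other than `u`
      -- that separates `x` from `u`; only `v` is available.
      with proj₂ wtr u x (x∈p∪q⁺ (inj₁ (x∈⁅x⁆ u)))
             (λ x∈W → case x∈⁅y⁆∪⁅z⁆⇒x≡y⊎x≡z x∈W of λ { (inj₁ e) → x≢u e ; (inj₂ e) → x≢v e })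
    ...   | w , w∈ , ne with x∈⁅y⁆∪⁅z⁆⇒x≡y⊎x≡z (p─q⊆p (⁅ u ⁆ ∪ ⁅ v ⁆) ⁅ u ⁆ w∈)
    ...     | inj₁ refl = contradiction w∈ (x∉p-x (⁅ u ⁆ ∪ ⁅ v ⁆) u)
    ...     | inj₂ refl = contradiction eq ne

    open Coordinates u v resolve public
    open Isolated isolated public

theorem2 : (n : ℕ) (G : Graph n) (connected : Graph.Connected G) →
    let open Graph G
        open Metric G connected
    in
    (u v : Fin n) →
    dimwt ≡ 2 →
    IsWTMetricBasis (⁅ u ⁆ ∪ ⁅ v ⁆) →
      ∃! _≡_ (IsGeodesic u v)
    × ((∀ z → z ∈ N u → degree z ≤ 3) × (∀ z → z ∈ N v → degree z ≤ 3))
    × (∀ P → IsGeodesic u v P → ∀ x → x ∈ₗ P →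
         x ≢ u → x ≢ v → x ∉ N u → x ∉ N v → degree x ≤ 5)
    × maxDegree ≤ 8
    × (∀ w → w ∈ ⁅ u ⁆ ∪ ⁅ v ⁆ → ∀ z → z ∈ N w → ∀ r → r ∈ N z → ¬ (r ∼ w))
theorem2 n G connected u v dim≡2 (wtr , card) =
    U.geodesic-∃!
  , ( (λ _ → U.neighbor-degree≤3 ∘ ∼-sym ∘ ∈N⇒∼)
    , (λ _ → V.neighbor-degree≤3 ∘ ∼-sym ∘ ∈N⇒∼))
  , (λ _ geo _ x∈P _ _ _ _ → U.geodesic-degree≤5 geo x∈P)
  -- `z≤n` covers the default value 0 in `maxDegree`.
  , max≤v⁺ z≤n (map⁺ {xs = allFin n} (tabulate λ {x} _ → U.degree≤8 x))
  , λ w w∈W z z∈N r r∈N r∼w → case x∈⁅y⁆∪⁅z⁆⇒x≡y⊎x≡z w∈W of λ where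
      (inj₁ refl) → U.triangle-free (∼-sym (∈N⇒∼ z∈N)) r∼w (∈N⇒∼ r∈N)
      (inj₂ refl) → V.triangle-free (∼-sym (∈N⇒∼ z∈N)) r∼w (∈N⇒∼ r∈N)
  where
  open Graph G
  open Metric G connected
  open Distance G connected
  u≢v : u ≢ v
  u≢v = ∣⁅x⁆∪⁅y⁆∣≡2⇒x≢y (trans card dim≡2)
  module U = Basis u v u≢v wtr
  -- `Basis` treats the neighbors of its first vertex only; exchanging the two vertices gives the
  -- claims about `v`.
  module V = Basis v u (u≢v ∘ sym) (subst IsWTR (∪-comm ⁅ u ⁆ ⁅ v ⁆) wtr)
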